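{- For $n \ge 8$, let $\mu(n)$ be the minimum number of edges of a connected non-prime graph of order $n$. Then $\mu(n) \le n+1$ if $n$ is even, and $\mu(n) \le n+2$ if $n$ is odd.
   Context: Graphs are finite and simple. A prime labeling of a graph $G$ of order $n$ is a bijection $\alpha: V(G) \to \{1,2,\dots,n\}$ such that $\gcd(\alpha(u),\alpha(v)) = 1$ for every edge $uv \in E(G)$. $G$ is prime if it admits a prime labeling, and non-prime otherwise. -}

module Defs where

open import Data.Bool.Base using (Bool; false; T)
open import Data.Bool.Properties using (T?)
open import Data.Fin.Base using (Fin; toℕ)
open import Data.Fin.Properties using (_<?_)
open import Data.List.Base using (List; length; filter; cartesianProduct; allFin)
open import Data.Nat.Base using (ℕ; suc; _≤_)
open import Data.Nat.GCD using (gcd)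
open import Data.Product.Base using (_×_; _,_; ∃; ∃-syntax)
open import Function.Bundles using (_⤖_; module Bijection)
open import Relation.Binary.Construct.Closure.ReflexiveTransitive using (Star)
open import Relation.Binary.PropositionalEquality using (_≡_)
open import Relation.Nullary using (¬_)
open import Relation.Nullary.Decidable using (_×-dec_)

record Graph (n : ℕ) : Set where
  field
    adj        : Fin n → Fin n → Bool
    adj-sym    : ∀ u v → adj u v ≡ adj v u
    adj-irrefl : ∀ v → adj v v ≡ false

  _~_ : Fin n → Fin n → Set
  u ~ v = T (adj u v)

  -- Each edge uv is listed once, as the pair (u , v) with u < v.
  edges : List (Fin n × Fin n)
  edges = filter (λ (u , v) → (u <? v) ×-dec T? (adj u v))
                 (cartesianProduct (allFin n) (allFin n))

  edgeCount : ℕ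
  edgeCount = length edges

  Connected : Set
  Connected = ∀ u v → Star _~_ u v

  -- The label set {1,…,n} is encoded by Fin n, with i standing for 1 + i.
  label : Fin n ⤖ Fin n → Fin n → ℕ
  label α v = suc (toℕ (Bijection.to α v))

  IsPrimeLabeling : Fin n ⤖ Fin n → Set
  IsPrimeLabeling α = ∀ u v → u ~ v → gcd (label α u) (label α v) ≡ 1

  IsPrime : Set
  IsPrime = ∃[ α ] IsPrimeLabeling α

  NonPrime : Set
  NonPrime = ¬ IsPrime

IsMinimum : (ℕ → Set) → ℕ → Set
IsMinimum P m = P m × (∀ k → P k → m ≤ k)

ConnectedNonPrimeSize : ℕ → ℕ → Set
ConnectedNonPrimeSize n k =
  ∃ λ (G : Graph n) → Graph.Connected G × Graph.NonPrime G × Graph.edgeCount G ≡ k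

-- μ(n) = m, as a relation: μ is a priori partial, being defined at n only
-- when a connected non-prime graph of order n exists.
μ[_]≡_ : ℕ → ℕ → Set
μ[ n ]≡ m = IsMinimum (ConnectedNonPrimeSize n) m

{-# OPTIONS --safe #-}

-- A prime labeling of a graph of order n needs ⌊n/2⌋ pairwise non-adjacent
-- vertices for the even labels, so a graph covered by fewer than ⌊n/2⌋ cliques
-- is not prime.  Take a path on n = 3t + 2r vertices and add t chords, turning
-- the first 3t vertices into t consecutive triangles: t triangles and r edges
-- cover it, and t + r < ⌊n/2⌋ once t ≥ 2.  It has n − 1 + t edges; use t = 2 for
-- even n and t = 3 for odd n.  The least size exists because the property of
-- being the size of a connected non-prime graph of order n is decidable.
module Submission where

open import Data.Bool.Base using (Bool; true; false; T)
open import Data.Bool.Properties using (T?) renaming (_≟_ to _≟ᵇ_)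
open import Data.Fin.Base using (Fin; zero; suc; toℕ; fromℕ<)
import Data.Fin.Base as Fin
open import Data.Fin.Induction using (<-weakInduction)
open import Data.Fin.Properties
  using (any?; all?; pigeonhole; injective⇒≤; toℕ<n; toℕ-injective; toℕ-fromℕ<; toℕ-inject₁;
         fromℕ<-injective)
  renaming (_≟_ to _≟ᶠ_; _<?_ to _<ᶠ?_)
open import Data.List.Base using (List; []; _∷_; _++_; length; lookup; map; allFin; cartesianProduct; upTo)
open import Data.List.Membership.Propositional using (_∈_)
open import Data.List.Membership.Propositional.Properties
  using (∈-allFin; ∈-lookup; ∈-map⁺; ∈-map⁻; ∈-++⁺ˡ; ∈-++⁺ʳ; ∈-upTo⁺; ∈-filter⁻)
import Data.List.Membership.Setoid.Properties as Membershipₛ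
open import Data.List.Properties using (length-map; length-++; length-upTo; filter-≐)
import Data.List.Relation.Unary.All as All
open import Data.List.Relation.Unary.AllPairs using ([]; _∷_)
open import Data.List.Relation.Unary.Any using (here; there; index)
open import Data.List.Relation.Unary.Unique.Propositional using (Unique)
import Data.List.Relation.Unary.Unique.Propositional.Properties as Unique
open import Data.Nat.Base using (ℕ; zero; suc; pred; _≤_; _<_; _+_; _*_; _∸_; ⌊_/2⌋; z≤n; s≤s)
open import Data.Nat.Divisibility using (_∣_; _∤_; divides; divides-refl; ∣1⇒≡1)
open import Data.Nat.GCD using (gcd; gcd-greatest)
open import Data.Nat.Induction using (<-rec)
open import Data.Nat.Properties
open import Data.Product.Base using (_×_; _,_; ∃; ∃-syntax; proj₁; proj₂)
import Data.Product.Base as Product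
open import Data.Sum.Base using (_⊎_; inj₁; inj₂; [_,_]′)
import Data.Sum.Base as Sum
import Data.Vec.Functional as Vector
open import Data.Vec.Functional using (Vector)
open import Function.Base using (_∘_; id)
open import Function.Bundles using (mk⤖; mk⇔; module Bijection)
open import Level using (0ℓ)
open import Relation.Binary.Construct.Closure.ReflexiveTransitive using (Star; ε; _◅_; _◅◅_)
import Relation.Binary.Construct.Closure.ReflexiveTransitive as Star
open import Relation.Binary.Core using (Rel)
import Relation.Binary.Definitions as Binary
open import Relation.Binary.PropositionalEquality
  using (_≡_; _≢_; refl; sym; trans; cong; cong₂; subst; setoid; module ≡-Reasoning)
open import Relation.Nullary using (¬_; Dec; does; yes; no; contradiction)
open import Relation.Nullary.Decidable
  using (_×-dec_; _⊎-dec_; _→-dec_; ¬?; map′; isYes; isYes≗does; does-⇔; dec-false;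
         toWitness; fromWitness)
open import Relation.Unary using (Decidable)
open import Defs

open Graph using (adj; _~_; edges; edgeCount; Connected; IsPrime; NonPrime)

-- Exhaustive search over finite types, and least witnesses.

-- The relation is a parameter because functions on `Fin n` are compared pointwise, without function
-- extensionality; a searched predicate must therefore respect it.
Exhaustible : (A : Set) → Rel A 0ℓ → Set₁
Exhaustible A _≈_ = {P : A → Set} → P Binary.Respects _≈_ → Decidable P → Dec (∃ P)

Bool-exhaustible : Exhaustible Bool _≡_
Bool-exhaustible resp P? = map′
  [ true ,_ , false ,_ ]′
  (λ { (true , p) → inj₁ p ; (false , p) → inj₂ p })
  (P? true ⊎-dec P? false)

Fin-exhaustible : ∀ n → Exhaustible (Fin n) _≡_
Fin-exhaustible n _ = any?

-- Search for a head that admits a suitable tail. A vector `f` agrees only pointwise with the one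
-- rebuilt from its head and tail, hence the uses of `resp`.
Vector-exhaustible : {A : Set} {_≈_ : Rel A 0ℓ} → Binary.Reflexive _≈_ → Exhaustible A _≈_ →
                     ∀ n → Exhaustible (Vector A n) (λ f g → ∀ i → f i ≈ g i)
Vector-exhaustible ≈-refl search zero resp P? =
  map′ (_ ,_) (λ (f , p) → resp (λ ()) p) (P? Vector.[])
Vector-exhaustible {A} {_≈_} ≈-refl search (suc n) {P} resp P? = map′
  (λ (a , f , p) → a Vector.∷ f , p)
  (λ (f , p) → f zero , f ∘ suc , resp (λ { zero → ≈-refl ; (suc i) → ≈-refl }) p)
  (search (λ a≈b (f , p) → f , resp (λ { zero → a≈b ; (suc i) → ≈-refl }) p)
    λ a → Vector-exhaustible {_≈_ = _≈_} ≈-refl search n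
      (λ f≈g → resp λ { zero → ≈-refl ; (suc i) → f≈g i })
      (P? ∘ (a Vector.∷_)))

least : {P : ℕ → Set} → Decidable P → ∀ m → P m → ∃[ k ] IsMinimum P k × k ≤ m
least {P} P? = <-rec (λ m → P m → ∃[ k ] IsMinimum P k × k ≤ m) step
  where
  step : ∀ m → (∀ {j} → j < m → P j → ∃[ k ] IsMinimum P k × k ≤ j) → P m → ∃[ k ] IsMinimum P k × k ≤ m
  step m rec Pm with anyUpTo? P? m
  ... | no ∄ = m , (Pm , λ j Pj → ≮⇒≥ λ j<m → ∄ (j , j<m , Pj)) , ≤-refl
  ... | yes (j , j<m , Pj) with k , isMin , k≤j ← rec j<m Pj = k , isMin , ≤-trans k≤j (<⇒≤ j<m)

-- Decidability of reachability.

module _ {n : ℕ} {_⟶_ : Rel (Fin n) 0ℓ} (_⟶?_ : Binary.Decidable _⟶_) where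

  -- Warshall's recursion: walks all of whose inner vertices lie in the list.
  Via : List (Fin n) → Rel (Fin n) 0ℓ
  Via []       u v = u ≡ v ⊎ u ⟶ v
  Via (x ∷ xs) u v = Via xs u v ⊎ Via xs u x × Via xs x v

  via? : ∀ xs → Binary.Decidable (Via xs)
  via? []       u v = (u ≟ᶠ v) ⊎-dec (u ⟶? v)
  via? (x ∷ xs) u v = via? xs u v ⊎-dec (via? xs u x ×-dec via? xs x v)

  via-[] : ∀ xs {u v} → Via [] u v → Via xs u v
  via-[] []       = id
  via-[] (_ ∷ xs) = inj₁ ∘ via-[] xs

  via⇒star : ∀ xs {u v} → Via xs u v → Star _⟶_ u v
  via⇒star []       (inj₁ refl)    = ε
  via⇒star []       (inj₂ u⟶v)     = u⟶v ◅ ε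
  via⇒star (x ∷ xs) (inj₁ p)       = via⇒star xs p
  via⇒star (x ∷ xs) (inj₂ (p , q)) = via⇒star xs p ◅◅ via⇒star xs q

  -- If `x` is the head, returns to `x` inside either walk are discarded. If the head is another
  -- vertex that both walks visit, the loop between the two visits is cut out, so one visit remains.
  via-join : ∀ {xs u x v} → x ∈ xs → Via xs u x → Via xs x v → Via xs u v
  via-join (here refl) p q = inj₂ ([ id , proj₁ ]′ p , [ id , proj₂ ]′ q)
  via-join (there x∈)  (inj₁ p)       (inj₁ q)       = inj₁ (via-join x∈ p q)
  via-join (there x∈)  (inj₁ p)       (inj₂ (q , r)) = inj₂ (via-join x∈ p q , r)
  via-join (there x∈)  (inj₂ (p , q)) (inj₁ r)       = inj₂ (p , via-join x∈ q r)
  via-join (there x∈)  (inj₂ (p , _)) (inj₂ (_ , r)) = inj₂ (p , r)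

  star⇒via : ∀ {u v} → Star _⟶_ u v → Via (allFin n) u v
  star⇒via ε         = via-[] (allFin n) (inj₁ refl)
  star⇒via (u⟶w ◅ p) = via-join (∈-allFin _) (via-[] (allFin n) (inj₂ u⟶w)) (star⇒via p)

  star? : Binary.Decidable (Star _⟶_)
  star? u v = map′ (via⇒star (allFin n)) star⇒via (via? (allFin n) u v)

-- Decidability of being the size of a connected non-prime graph.

connected? : ∀ {n} → Decidable (Connected {n})
connected? G = all? λ u → all? λ v → star? (λ x y → T? (adj G x y)) u v

isPrime? : ∀ {n} → Decidable (IsPrime {n})
isPrime? {n} G = map′
  (λ (f , (inj , surj) , coprime) →
    mk⤖ {to = f} ((λ {x} {y} → inj x y) , λ y → proj₁ (surj y) , λ { refl → proj₂ (surj y) }) ,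
    coprime)
  (λ (α , prime) →
    Bijection.to α , ((λ x y → Bijection.injective α) , Bijection.strictlySurjective α) , prime)
  (Vector-exhaustible refl (Fin-exhaustible n) n resp
    λ f →
      ((all? λ x → all? λ y → (f x ≟ᶠ f y) →-dec (x ≟ᶠ y)) ×-dec
       (all? λ y → any? λ x → f x ≟ᶠ y)) ×-dec
      (all? λ u → all? λ v →
        T? (adj G u v) →-dec (gcd (suc (toℕ (f u))) (suc (toℕ (f v))) ≟ 1)))
  where
  IsLabeling : (Fin n → Fin n) → Set
  IsLabeling f =
    ((∀ x y → f x ≡ f y → x ≡ y) × (∀ y → ∃[ x ] f x ≡ y)) ×
    (∀ u v → _~_ G u v → gcd (suc (toℕ (f u))) (suc (toℕ (f v))) ≡ 1)

  resp : IsLabeling Binary.Respects (λ f g → ∀ i → f i ≡ g i)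
  resp f≗g ((inj , surj) , coprime) =
    ( (λ x y gx≡gy → inj x y (trans (f≗g x) (trans gx≡gy (sym (f≗g y)))))
    , (λ y → Product.map₂ (trans (sym (f≗g _))) (surj y)) ) ,
    λ u v u~v → trans
      (sym (cong₂ (λ a b → gcd (suc (toℕ a)) (suc (toℕ b))) (f≗g u) (f≗g v)))
      (coprime u v u~v)

edge? : ∀ {n} (G : Graph n) ((u , v) : Fin n × Fin n) → Dec (u Fin.< v × _~_ G u v)
edge? G (u , v) = (u <ᶠ? v) ×-dec T? (adj G u v)

HasSize : ∀ {n} → ℕ → Graph n → Set
HasSize k G = Connected G × NonPrime G × edgeCount G ≡ k

-- Lets one graph stand for all graphs with pointwise equal adjacency, which need not be equal as
-- records.
hasSize-resp : ∀ {n k} (G H : Graph n) → (∀ u v → adj G u v ≡ adj H u v) → HasSize k G → HasSize k H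
hasSize-resp G H G≗H (connected , nonPrime , size) =
  (λ u v → Star.map ⇒ (connected u v)) ,
  (λ (α , prime) → nonPrime (α , λ u v → prime u v ∘ ⇒)) ,
  trans (sym (cong length sameEdges)) size
  where
  ⇒ : ∀ {u v} → _~_ G u v → _~_ H u v
  ⇒ = subst T (G≗H _ _)

  ⇐ : ∀ {u v} → _~_ H u v → _~_ G u v
  ⇐ = subst T (sym (G≗H _ _))

  sameEdges : edges G ≡ edges H
  sameEdges = filter-≐ (edge? G) (edge? H) (Product.map₂ ⇒ , Product.map₂ ⇐)
    (cartesianProduct (allFin _) (allFin _))

connectedNonPrimeSize? : ∀ n → Decidable (ConnectedNonPrimeSize n)
connectedNonPrimeSize? n k = map′
  (λ (_ , G , _ , size) → G , size)
  (λ (G , size) → adj G , G , (λ _ _ → refl) , size)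
  (Vector-exhaustible (λ _ → refl) (Vector-exhaustible refl Bool-exhaustible n) n
    (λ A≗B → Product.map₂ (Product.map₁ λ G≗A u v → trans (G≗A u v) (A≗B u v)))
    realized?)
  where
  -- Mentioning `A` only through pointwise agreement makes this meaningful for every Boolean matrix
  -- and invariant under pointwise equality.
  Realized : (Fin n → Fin n → Bool) → Set
  Realized A = ∃[ G ] (∀ u v → adj G u v ≡ A u v) × HasSize k G

  realized? : Decidable Realized
  realized? A with (all? λ u → all? λ v → A u v ≟ᵇ A v u) ×-dec (all? λ v → A v v ≟ᵇ false)
  ... | no ¬simple = no λ (G , G≗A , _) → ¬simple
    ( (λ u v → trans (sym (G≗A u v)) (trans (Graph.adj-sym G u v) (G≗A v u)))
    , (λ v → trans (sym (G≗A v v)) (Graph.adj-irrefl G v)) )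
  -- Every graph realizing `A` agrees pointwise with `H`, so testing `H` settles the matter.
  ... | yes (A-sym , A-irrefl) = map′
    (λ size → H , (λ _ _ → refl) , size)
    (λ (G , G≗A , size) → hasSize-resp G H G≗A size)
    (connected? H ×-dec ¬? (isPrime? H) ×-dec (edgeCount H ≟ k))
    where
    H : Graph n
    H = record { adj = A ; adj-sym = A-sym ; adj-irrefl = A-irrefl }

-- Clique covers obstruct prime labelings.

-- The cliques are the fibres of `κ`. The labels 2, 4, ..., 2(c + 1) occur by `bound`, and the
-- pigeonhole principle puts two of their vertices in one fibre; these are adjacent, yet 2 divides
-- both labels.
cliqueCover⇒nonPrime : ∀ {n c} (G : Graph n) (κ : Fin n → Fin c) →
                       (∀ u v → u ≢ v → κ u ≡ κ v → _~_ G u v) →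
                       suc c * 2 ≤ n → NonPrime G
cliqueCover⇒nonPrime {n} {c} G κ clique bound (α , prime) = twoEvenInClique (pigeonhole (n<1+n c) (κ ∘ evenVertex))
  where
  -- Position `k` carries label `k + 1`, so the even label `2(i + 1)` sits at position `2i + 1`.
  index<n : (i : Fin (suc c)) → suc (toℕ i * 2) < n
  index<n i = ≤-trans (*-monoˡ-≤ 2 (toℕ<n i)) bound

  evenVertex : Fin (suc c) → Fin n
  evenVertex i = proj₁ (Bijection.strictlySurjective α (fromℕ< (index<n i)))

  label≡ : ∀ i → Graph.label G α (evenVertex i) ≡ suc (toℕ i) * 2
  label≡ i = cong suc (trans
    (cong toℕ (proj₂ (Bijection.strictlySurjective α (fromℕ< (index<n i)))))
    (toℕ-fromℕ< (index<n i)))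

  2∣label : ∀ i → 2 ∣ Graph.label G α (evenVertex i)
  2∣label i = divides (suc (toℕ i)) (label≡ i)

  evenVertex-injective : ∀ {i j} → evenVertex i ≡ evenVertex j → i ≡ j
  evenVertex-injective {i} {j} eq = toℕ-injective (suc-injective (*-cancelʳ-≡ _ _ 2
    (trans (sym (label≡ i)) (trans (cong (Graph.label G α) eq) (label≡ j)))))

  twoEvenInClique : ¬ (∃[ i ] ∃[ j ] (i Fin.< j × κ (evenVertex i) ≡ κ (evenVertex j)))
  twoEvenInClique (i , j , i<j , κi≡κj) = contradiction
    (∣1⇒≡1 (subst (2 ∣_) (prime _ _ i~j) (gcd-greatest (2∣label i) (2∣label j)))) λ ()
    where
    i~j : _~_ G (evenVertex i) (evenVertex j)
    i~j = clique _ _ (<⇒≢ i<j ∘ cong toℕ ∘ evenVertex-injective) κi≡κj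

-- Bounding the number of edges by a list.

Unique-lookup-injective : ∀ {A : Set} {xs : List A} → Unique xs →
                          ∀ i j → lookup xs i ≡ lookup xs j → i ≡ j
Unique-lookup-injective (_ ∷ _)    zero    zero    _  = refl
Unique-lookup-injective (x∉ ∷ _)   zero    (suc j) eq = contradiction eq (All.lookup x∉ (∈-lookup j))
Unique-lookup-injective (x∉ ∷ _)   (suc i) zero    eq = contradiction (sym eq) (All.lookup x∉ (∈-lookup i))
Unique-lookup-injective (_ ∷ uniq) (suc i) (suc j) eq = cong suc (Unique-lookup-injective uniq i j eq)

-- Sending each position of `xs` to a position of the same entry in `ys` is injective, since the
-- entries of `xs` are distinct.
Unique-⊆⇒length≤ : ∀ {A : Set} {xs ys : List A} → Unique xs →
                   (∀ {x} → x ∈ xs → x ∈ ys) → length xs ≤ length ys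
Unique-⊆⇒length≤ {A} {xs} {ys} uniq xs⊆ys = injective⇒≤ {f = λ i → index (xs⊆ys (∈-lookup {xs = xs} i))}
  λ {i} {j} eq → Unique-lookup-injective uniq i j
    (Membershipₛ.index-injective (setoid A) (xs⊆ys (∈-lookup i)) (xs⊆ys (∈-lookup j)) eq)

edgeCount≤length : ∀ {n} (G : Graph n) (es : List (ℕ × ℕ)) →
                   (∀ u v → toℕ u < toℕ v → _~_ G u v → (toℕ u , toℕ v) ∈ es) →
                   edgeCount G ≤ length es
edgeCount≤length {n} G es covers = subst (_≤ length es) (length-map toℕ² (edges G))
  (Unique-⊆⇒length≤ unique listed)
  where
  toℕ² : Fin n × Fin n → ℕ × ℕ
  toℕ² = Product.map toℕ toℕ

  toℕ²-injective : ∀ {p q} → toℕ² p ≡ toℕ² q → p ≡ q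
  toℕ²-injective eq =
    cong₂ _,_ (toℕ-injective (cong proj₁ eq)) (toℕ-injective (cong proj₂ eq))

  unique : Unique (map toℕ² (edges G))
  unique = Unique.map⁺ toℕ²-injective
    (Unique.filter⁺ (edge? G) (Unique.cartesianProduct⁺ (Unique.allFin⁺ n) (Unique.allFin⁺ n)))

  listed : ∀ {x} → x ∈ map toℕ² (edges G) → x ∈ es
  listed x∈ with (u , v) , e∈ , refl ← ∈-map⁻ toℕ² x∈
    with _ , u<v , u~v ← ∈-filter⁻ (edge? G) {xs = cartesianProduct (allFin n) (allFin n)} e∈
    = covers u v u<v u~v

-- Paths with blocks completed to cliques.

-- The path 0 – 1 – ⋯ – (n − 1) with every fibre of b completed to a clique.
module BlockPath (b : ℕ → ℕ) (n : ℕ) where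

  Adjacent : ℕ → ℕ → Set
  Adjacent i j = i ≢ j × (b i ≡ b j ⊎ j ≡ suc i ⊎ i ≡ suc j)

  adjacent? : Binary.Decidable Adjacent
  adjacent? i j = ¬? (i ≟ j) ×-dec ((b i ≟ b j) ⊎-dec ((j ≟ suc i) ⊎-dec (i ≟ suc j)))

  adjacent-sym : ∀ {i j} → Adjacent i j → Adjacent j i
  adjacent-sym = Product.map (_∘ sym) (Sum.map sym Sum.swap)

  graph : Graph n
  graph = record
    { adj        = λ u v → isYes (adjacent? (toℕ u) (toℕ v))
    ; adj-sym    = λ u v → isYes-sym (toℕ u) (toℕ v)
    ; adj-irrefl = λ v → trans
        (isYes≗does _)
        (dec-false (adjacent? _ _) λ (v≢v , _) → v≢v refl)
    }
    where
    isYes-sym : ∀ i j → isYes (adjacent? i j) ≡ isYes (adjacent? j i)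
    isYes-sym i j = begin
      isYes (adjacent? i j) ≡⟨ isYes≗does (adjacent? i j) ⟩
      does (adjacent? i j)  ≡⟨ does-⇔ (mk⇔ adjacent-sym adjacent-sym) (adjacent? i j) (adjacent? j i) ⟩
      does (adjacent? j i)  ≡⟨ isYes≗does (adjacent? j i) ⟨
      isYes (adjacent? j i) ∎
      where open ≡-Reasoning

  adjacent⇒~ : ∀ {u v} → Adjacent (toℕ u) (toℕ v) → _~_ graph u v
  adjacent⇒~ = fromWitness

  ~⇒adjacent : ∀ {u v} → _~_ graph u v → Adjacent (toℕ u) (toℕ v)
  ~⇒adjacent = toWitness

  consecutive⇒~ : ∀ {u v} → toℕ v ≡ suc (toℕ u) → _~_ graph u v
  consecutive⇒~ v≡1+u = adjacent⇒~ ((λ u≡v → 1+n≢n (trans (sym v≡1+u) (sym u≡v))) , inj₂ (inj₁ v≡1+u))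

blockPath-connected : ∀ b n → Connected (BlockPath.graph b n)
blockPath-connected b (suc n) u v = Star.reverse ~-sym (fromZero u) ◅◅ fromZero v
  where
  open BlockPath b (suc n)

  ~-sym : ∀ {u v} → _~_ graph u v → _~_ graph v u
  ~-sym = adjacent⇒~ ∘ adjacent-sym ∘ ~⇒adjacent

  fromZero : ∀ v → Star (_~_ graph) zero v
  fromZero = <-weakInduction (Star (_~_ graph) zero) ε
    λ i p → p ◅◅ consecutive⇒~ (cong suc (sym (toℕ-inject₁ i))) ◅ ε

-- An edge either joins consecutive vertices, which gives `pred n` pairs, or spans a gap of at least
-- two and so lies inside a block.
blockPath-edgeCount≤ : ∀ b n chords →
                       (∀ i j → suc i < j → b i ≡ b j → (i , j) ∈ chords) →
                       edgeCount (BlockPath.graph b n) ≤ length chords + pred n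
blockPath-edgeCount≤ b n chords covers = ≤-trans
  (edgeCount≤length graph (chords ++ map step (upTo (pred n))) listed)
  (≤-reflexive (trans (length-++ chords)
    (cong (length chords +_) (trans (length-map step (upTo (pred n))) (length-upTo (pred n))))))
  where
  open BlockPath b n

  step : ℕ → ℕ × ℕ
  step i = i , suc i

  listed : ∀ u v → toℕ u < toℕ v → _~_ graph u v → (toℕ u , toℕ v) ∈ chords ++ map step (upTo (pred n))
  listed u v u<v u~v with ~⇒adjacent {u} {v} u~v | toℕ v ≟ suc (toℕ u)
  ... | _ | yes v≡1+u = subst (λ j → (toℕ u , j) ∈ _) (sym v≡1+u)
    (∈-++⁺ʳ chords (∈-map⁺ step (∈-upTo⁺ (suc[m]≤n⇒m≤pred[n] (subst (_< n) v≡1+u (toℕ<n v))))))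
  ... | _ , inj₁ bu≡bv        | no v≢1+u = ∈-++⁺ˡ (covers _ _ (≤∧≢⇒< u<v (v≢1+u ∘ sym)) bu≡bv)
  ... | _ , inj₂ (inj₁ v≡1+u) | no v≢1+u = contradiction v≡1+u v≢1+u
  ... | _ , inj₂ (inj₂ u≡1+v) | no _     =
    contradiction (subst (toℕ v <_) (sym u≡1+v) (n<1+n _)) (<-asym u<v)

-- Triangles followed by single edges.

-- Numbers the cliques from left to right: `t` consecutive triples, then consecutive pairs. The path
-- already contains each pair's edge and all of a triple's edges except the one joining its ends.
block : ℕ → ℕ → ℕ
block zero    j                   = ⌊ j /2⌋
block (suc t) (suc (suc (suc j))) = suc (block t j)
block (suc t) _                   = 0

triangleChords : ℕ → List (ℕ × ℕ)
triangleChords zero    = []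
triangleChords (suc t) = (0 , 2) ∷ map (Product.map (3 +_) (3 +_)) (triangleChords t)

length-triangleChords : ∀ t → length (triangleChords t) ≡ t
length-triangleChords zero    = refl
length-triangleChords (suc t) = cong suc (trans (length-map _ (triangleChords t)) (length-triangleChords t))

⌊/2⌋-separates : ∀ i j → suc i < j → ⌊ i /2⌋ ≢ ⌊ j /2⌋
⌊/2⌋-separates i (suc (suc j)) (s≤s (s≤s i≤j)) eq =
  <-irrefl eq (s≤s (⌊n/2⌋-mono i≤j))

-- Blocks are intervals of length two or three, so a gap of at least two inside a block can only be
-- the two ends of a triple.
block-chords : ∀ t i j → suc i < j → block t i ≡ block t j → (i , j) ∈ triangleChords t
block-chords zero    i j 1+i<j eq = contradiction eq (⌊/2⌋-separates i j 1+i<j)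
block-chords (suc t) 0 2 _ _ = here refl
block-chords (suc t) 0 (suc (suc (suc j))) _ ()
block-chords (suc t) 1 (suc (suc (suc j))) _ ()
block-chords (suc t) 2 (suc (suc (suc j))) _ ()
block-chords (suc t) (suc (suc (suc i))) (suc (suc (suc j))) (s≤s (s≤s (s≤s 1+i<j))) eq =
  there (∈-map⁺ _ (block-chords t i j 1+i<j (suc-injective eq)))
block-chords (suc t) 0 1 (s≤s ()) _
block-chords (suc t) (suc _) 1 (s≤s ()) _
block-chords (suc t) (suc _) 2 (s≤s (s≤s ())) _

block-bound : ∀ t r j → j < t * 3 + r * 2 → block t j < t + r
block-bound zero    (suc r) 0             _ = s≤s z≤n
block-bound zero    (suc r) 1             _ = s≤s z≤n
block-bound zero    (suc r) (suc (suc j)) (s≤s (s≤s j<)) = s≤s (block-bound zero r j j<)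
block-bound (suc t) r 0 _ = s≤s z≤n
block-bound (suc t) r 1 _ = s≤s z≤n
block-bound (suc t) r 2 _ = s≤s z≤n
block-bound (suc t) r (suc (suc (suc j))) (s≤s (s≤s (s≤s j<))) = s≤s (block-bound t r j j<)

-- Two triangles cover six vertices with two cliques where edges would take three; this saves the
-- one clique that the obstruction demands, hence the `2 + t`.
trianglePath-size : ∀ t r → let n = (2 + t) * 3 + r * 2 in
                    ∃[ k ] ConnectedNonPrimeSize n k × k ≤ (2 + t) + pred n
trianglePath-size t r = edgeCount graph ,
  (graph , blockPath-connected b n , cliqueCover⇒nonPrime graph κ clique bound , refl) ,
  subst (λ l → edgeCount graph ≤ l + pred n) (length-triangleChords (2 + t))
    (blockPath-edgeCount≤ b n (triangleChords (2 + t)) (block-chords (2 + t)))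
  where
  n = (2 + t) * 3 + r * 2
  b = block (2 + t)
  open BlockPath b n

  κ : Fin n → Fin (2 + t + r)
  κ v = fromℕ< (block-bound (2 + t) r (toℕ v) (toℕ<n v))

  clique : ∀ u v → u ≢ v → κ u ≡ κ v → _~_ graph u v
  clique u v u≢v eq = adjacent⇒~ (u≢v ∘ toℕ-injective , inj₁ (fromℕ<-injective _ _ _ _ eq))

  bound : (3 + t + r) * 2 ≤ n
  -- Both sides reduce to `6 +` a remainder, leaving `(t + r) * 2 ≤ t * 3 + r * 2`.
  bound = +-monoʳ-≤ 6 (≤-trans
    (≤-reflexive (*-distribʳ-+ 2 t r))
    (+-monoˡ-≤ (r * 2) (*-monoʳ-≤ t (n≤1+n 2))))

-- Choice of the number of triangles by parity.

-- The offsets 6 and 9 are the vertices of two and three triangles, so the indices match the order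
-- in `trianglePath-size` at `t = 0` and `t = 1`.
data EvenOrOdd : ℕ → Set where
  even : ∀ r → EvenOrOdd (6 + r * 2)
  odd  : ∀ r → EvenOrOdd (9 + r * 2)

evenOrOdd : ∀ n → 8 ≤ n → EvenOrOdd n
evenOrOdd n 8≤n = subst EvenOrOdd (m+[n∸m]≡n 8≤n) (from8 (n ∸ 8))
  where
  next : ∀ {n} → EvenOrOdd n → EvenOrOdd (2 + n)
  next (even r) = even (suc r)
  next (odd r)  = odd (suc r)

  from8 : ∀ m → EvenOrOdd (8 + m)
  from8 0             = even 1
  from8 1             = odd 0
  from8 (suc (suc m)) = next (from8 m)

minimumSize≤ : ∀ {n b} → ∃[ k ] ConnectedNonPrimeSize n k × k ≤ b → ∃[ m ] (μ[ n ]≡ m) × m ≤ b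
minimumSize≤ {n} (k , size , k≤b) =
  Product.map₂ (Product.map₂ λ m≤k → ≤-trans m≤k k≤b) (least (connectedNonPrimeSize? n) k size)

theorem10p3 : (n : ℕ) → 8 ≤ n → ∃[ m ] ((μ[ n ]≡ m) × (2 ∣ n → m ≤ n + 1) × (2 ∤ n → m ≤ n + 2))
theorem10p3 n 8≤n = bound (evenOrOdd n 8≤n)
  where
  bound : ∀ {n} → EvenOrOdd n → ∃[ m ] ((μ[ n ]≡ m) × (2 ∣ n → m ≤ n + 1) × (2 ∤ n → m ≤ n + 2))
  bound (even r) = Product.map₂ (Product.map₂ λ m≤ →
    -- The bound `2 + pred n` computes to `1 + n`; with three triangles, `3 + pred n` computes to
    -- `2 + n`.
    (λ _ → ≤-trans m≤ (≤-reflexive (+-comm 1 (6 + r * 2)))) ,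
    λ 2∤n → contradiction (divides-refl (3 + r)) 2∤n)
    (minimumSize≤ (trianglePath-size 0 r))
  bound (odd r) = Product.map₂ (Product.map₂ λ m≤ →
    -- Here `n` is `1 + 2(4 + r)`, which cannot equal `2q`.
    (λ (divides q eq) → contradiction
      (trans (*-comm 2 q) (trans (sym eq) (cong suc (*-comm (4 + r) 2))))
      (even≢odd q (4 + r))) ,
    λ _ → ≤-trans m≤ (≤-reflexive (+-comm 2 (9 + r * 2))))
    (minimumSize≤ (trianglePath-size 1 r))
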